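{- Let $m,n,N$ be positive integers and for each $1\le i\le 2m$ let $\mathbf{x}^{(i)}=(\mathbf{x}^{(i)}_1,\dots,\mathbf{x}^{(i)}_n)$ be a sequence of $n$ variables. Then $$\sum_{\substack{\lambda:\ \ell(\lambda)\le n\\ \lambda_1\le N}}s_\lambda(\mathbf{x}^{(1)})s_\lambda(\mathbf{x}^{(2)})\cdots s_\lambda(\mathbf{x}^{(2m)})=\prod_{i=1}^{2m}\frac{1}{V(\mathbf{x}^{(i)})}\cdot\mathrm{Det}^{[2m]}\left(\frac{1-(\mathbf{x}^{(1)}_{i_1}\cdots\mathbf{x}^{(2m)}_{i_{2m}})^{n+N}}{1-\mathbf{x}^{(1)}_{i_1}\cdots\mathbf{x}^{(2m)}_{i_{2m}}}\right)_{1\le i_1,\dots,i_{2m}\le n},$$ the sum being over all partitions $\lambda$ with at most $n$ parts and largest part at most $N$.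
   Context: $V(\mathbf{x})=\prod_{1\le i<j\le n}(\mathbf{x}_i-\mathbf{x}_j)$ is the Vandermonde product; $s_\lambda(\mathbf{x})=\det(\mathbf{x}_i^{\lambda_j+n-j})_{1\le i,j\le n}/V(\mathbf{x})$ is the Schur polynomial in $n$ variables. Each entry $\frac{1-y^{n+N}}{1-y}$ means the polynomial $\sum_{k=0}^{n+N-1}y^k$. Hyperdeterminant: $\mathrm{Det}^{[2m]}(A):=\frac{1}{n!}\sum_{\sigma_1,\dots,\sigma_{2m}\in\mathfrak{S}_n}\mathrm{sgn}(\sigma_1)\cdots\mathrm{sgn}(\sigma_{2m})\prod_{i=1}^nA(\sigma_1(i),\dots,\sigma_{2m}(i))$. -}

module Defs where

open import Algebra.Bundles using (CommutativeRing)
import Algebra.Definitions as AlgDefs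
import Algebra.Properties.CommutativeMonoid.Sum as MonoidSum
import Algebra.Properties.Semiring.Exp as SemiringExp
import Algebra.Properties.Semiring.Mult as SemiringMult
open import Data.Bool.Base using (if_then_else_)
open import Data.Fin.Base using (Fin; zero; suc; toℕ)
open import Data.Fin.Permutation using (Permutation′; _⟨$⟩ʳ_; insert)
import Data.Fin.Permutation as Perm
open import Data.Fin.Properties using (_<?_)
open import Data.List.Base
  using (List; []; _∷_; map; foldr; concatMap; cartesianProductWith; allFin; upTo)
open import Data.Nat.Base as ℕ using (ℕ; zero; suc; _∸_; _!)
open import Data.Product.Base using (_,_)
open import Data.Vec.Base as Vec using (Vec; lookup)
open import Relation.Nullary.Decidable.Core using (does)

-- The elements of 𝔖ₙ, each listed once: `insert zero j π` sends 0 to j and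
-- restricts to π on the remaining points.
𝔖 : (n : ℕ) → List (Permutation′ n)
𝔖 zero    = Perm.id ∷ []
𝔖 (suc n) = cartesianProductWith (insert zero) (allFin (suc n)) (𝔖 n)

tuples : ∀ {a} {A : Set a} (r : ℕ) → List A → List (Vec A r)
tuples zero    xs = Vec.[] ∷ []
tuples (suc r) xs = cartesianProductWith Vec._∷_ xs (tuples r xs)

-- The partitions λ with ℓ(λ) ≤ n and λ₁ ≤ N, each listed once as a weakly
-- decreasing sequence N ≥ λ₁ ≥ … ≥ λₙ ≥ 0, padded with zeros to length n.
partitions : (n N : ℕ) → List (Vec ℕ n)
partitions zero    N = Vec.[] ∷ []
partitions (suc n) N =
  concatMap (λ k → map (k Vec.∷_) (partitions n k)) (upTo (suc N))

module OverRing {c ℓ} (R : CommutativeRing c ℓ) where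

  open CommutativeRing R
  open AlgDefs _≈_ using (Invertible)
  open MonoidSum +-commutativeMonoid using (sum)
  open MonoidSum *-commutativeMonoid using () renaming (sum to prod)
  open SemiringExp semiring using (_^_)
  open SemiringMult semiring using (_×_)

  ∏ : ∀ {n} → (Fin n → Carrier) → Carrier
  ∏ = prod

  ∑[_] : ∀ {a} {A : Set a} → List A → (A → Carrier) → Carrier
  ∑[ xs ] f = foldr _+_ 0# (map f xs)

  ∏< : ∀ {n} → (Fin n → Fin n → Carrier) → Carrier
  ∏< f = ∏ λ i → ∏ λ j → if does (i <? j) then f i j else 1#

  IsUnit : Carrier → Set _
  IsUnit = Invertible 1# _*_

  infixl 7 _/_
  _/_ : Carrier → {b : Carrier} → IsUnit b → Carrier
  a / (b⁻¹ , _) = a * b⁻¹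

  -- (-1) to the number of inversions
  sgn : ∀ {n} → Permutation′ n → Carrier
  sgn σ = ∏< λ i j → if does ((σ ⟨$⟩ʳ j) <? (σ ⟨$⟩ʳ i)) then - 1# else 1#

  det : ∀ {n} → (Fin n → Fin n → Carrier) → Carrier
  det {n} M = ∑[ 𝔖 n ] λ σ → sgn σ * ∏ λ i → M i (σ ⟨$⟩ʳ i)

  V : ∀ {n} → (Fin n → Carrier) → Carrier
  V x = ∏< λ i j → x i - x j

  -- `Fin n` counts from 0, so the exponent λⱼ + n - j (with 1 ≤ j ≤ n) becomes
  -- λⱼ + (n ∸ suc j).
  schur : ∀ {n} (x : Fin n → Carrier) → IsUnit (V x) → Vec ℕ n → Carrier
  schur {n} x V-unit lam =
    det (λ i j → x i ^ (lookup lam j ℕ.+ (n ∸ suc (toℕ j)))) / V-unit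

  -- The polynomial (1 - yᵏ)/(1 - y) = 1 + y + … + yᵏ⁻¹
  geometric : ℕ → Carrier → Carrier
  geometric k y = sum {k} λ j → y ^ toℕ j

  fromℕ : ℕ → Carrier
  fromℕ k = k × 1#

  -- Cayley's first hyperdeterminant of an array A of order r and side n;
  -- the entry with indices i₁, …, iᵣ is `A i`, where i sends p to iₚ.
  Det : ∀ {r n} → IsUnit (fromℕ (n !)) → ((Fin r → Fin n) → Carrier) → Carrier
  Det {r} {n} n!-unit A =
    (1# / n!-unit) *
    ∑[ tuples r (𝔖 n) ] λ σ →
      ∏ (λ p → sgn (lookup σ p)) * ∏ (λ i → A (λ p → lookup σ p ⟨$⟩ʳ i))

-- Expanding the geometric series in the hyperdeterminant and separating the sums
-- over the 2m permutations gives n!⁻¹ Σ_v ∏ₚ aᵥ(x⁽ᵖ⁾), where v runs over all words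
-- in {0, …, n + N - 1}ⁿ and aᵥ(x) = det (xⱼ ^ vᵢ). A product of an even number of
-- alternants is symmetric in v and vanishes when v has a repeated entry, so each
-- strictly decreasing v = λ + δ accounts for n! words, and
-- a_{λ+δ} / V = s_λ. The n!-fold counting is done by induction on the largest
-- letter, which is unused or used once, in one of n positions.
module Submission where

open import Defs
open import Algebra.Bundles using (CommutativeRing)
import Algebra.Properties.CommutativeMonoid.Sum as MonoidSum
import Algebra.Properties.CommutativeSemigroup as CommutativeSemigroupProperties
import Algebra.Properties.CommutativeSemiring.Exp as Exp
import Algebra.Properties.Ring as RingProperties
import Algebra.Properties.Semiring.Mult as SemiringMult
import Algebra.Properties.CommutativeMonoid.Mult as MonoidMult
import Algebra.Properties.Semiring.Sum as SemiringSum
import Algebra.Solver.CommutativeMonoid as CommutativeMonoidSolver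
open import Data.Bool.Base using (if_then_else_)
open import Data.Fin.Base using (Fin; zero; suc; toℕ; punchIn; pinch)
open import Data.Fin.Permutation using (Permutation′; _⟨$⟩ʳ_; insert)
open import Data.Fin.Properties using (_<?_)
open import Data.List.Base
  using ( List; []; _∷_; _++_; map; concatMap; cartesianProductWith
        ; tabulate; allFin; applyUpTo; upTo)
open import Data.List.Properties using (upTo-∷ʳ)
open import Data.Nat.Base as ℕ using (ℕ; NonZero; _!; _∸_; zero; suc; z≤n; s≤s; _<_)
import Data.Nat.Properties as ℕ
open import Data.Product.Base using (_×_; _,_)
open import Data.Unit.Polymorphic.Base using (⊤; tt)
open import Data.Vec.Base as Vec using (Vec; lookup)
open import Data.Vec.Properties using (lookup∘tabulate)
open import Function.Base using (_∘_; id)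
open import Level using (Level; _⊔_)
open import Relation.Binary.PropositionalEquality as ≡ using (_≡_)
import Relation.Binary.Reasoning.Setoid as SetoidReasoning
open import Relation.Nullary.Decidable.Core using (does)

private
  variable
    a : Level
    A B C : Set a
    k n r : ℕ

-- Deleting one or two indices

punchIn-<? : (j : Fin (suc n)) (a b : Fin n) →
             does (punchIn j a <? punchIn j b) ≡ does (a <? b)
punchIn-<? zero    a       b       = ≡.refl
punchIn-<? (suc j) zero    zero    = ≡.refl
punchIn-<? (suc j) zero    (suc b) = ≡.refl
punchIn-<? (suc j) (suc a) zero    = ≡.refl
punchIn-<? (suc j) (suc a) (suc b) = punchIn-<? j a b

-- (j , k) ↦ (punchIn j k , pinch k j) exchanges the two entries of the pair of
-- distinct indices (j , punchIn j k).
punchIn-pinch : (j : Fin (suc n)) (k : Fin n) → punchIn (punchIn j k) (pinch k j) ≡ j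
punchIn-pinch zero    zero    = ≡.refl
punchIn-pinch zero    (suc k) = ≡.refl
punchIn-pinch (suc j) zero    = ≡.refl
punchIn-pinch (suc j) (suc k) = ≡.cong suc (punchIn-pinch j k)

-- Both sides enumerate the indices other than `j` and `punchIn j k`, which are deleted in the two
-- possible orders.
punchIn-punchIn : (j : Fin (suc (suc n))) (k : Fin (suc n)) (c : Fin n) →
  punchIn j (punchIn k c) ≡ punchIn (punchIn j k) (punchIn (pinch k j) c)
punchIn-punchIn zero    zero    c       = ≡.refl
punchIn-punchIn zero    (suc k) c       = ≡.refl
punchIn-punchIn (suc j) zero    c       = ≡.refl
punchIn-punchIn (suc j) (suc k) zero    = ≡.refl
punchIn-punchIn (suc j) (suc k) (suc c) = ≡.cong suc (punchIn-punchIn j k c)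

-- λ + δ, where δ = (n - 1, …, 1, 0)
shift : Vec ℕ n → Vec ℕ n
shift {n} lam = Vec.tabulate λ j → lookup lam j ℕ.+ (n ∸ suc (toℕ j))

module _ {c ℓ} (R : CommutativeRing c ℓ) where

  open CommutativeRing R hiding (zero)
  open OverRing R
  open MonoidSum +-commutativeMonoid
    using (sum; sum-cong-≋; sum-replicate-zero; ∑-distrib-+; ∑-comm)
  open MonoidSum *-commutativeMonoid using ()
    renaming ( sum-cong-≋ to ∏-cong; sum-replicate-zero to ∏-replicate-1
             ; sum-replicate to ∏-replicate
             ; ∑-distrib-+ to ∏-distrib-*; ∑-comm to ∏-comm; sum-permute to ∏-permute)
  open SemiringSum semiring using (*-distribˡ-sum)
  open MonoidMult +-commutativeMonoid renaming (_×_ to _·_)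
    using (×-congʳ; ×-assocˡ; ×-distrib-+; ×-homo-1; ×-idem)
  open Exp commutativeSemiring using (_^_; ^-distrib-*; ^-assocʳ; ^-congˡ)
  open RingProperties ring using (-‿involutive; -1*x≈-x; +-inverseˡ-unique)
  open CommutativeSemigroupProperties *-commutativeSemigroup using (x∙yz≈y∙xz)
  open CommutativeMonoidSolver *-commutativeMonoid using (solve; _⊜_; _⊕_)
  open SetoidReasoning setoid

  -- Finite sums and products

  ∑-cong : (xs : List A) {f g : A → Carrier} → (∀ x → f x ≈ g x) → ∑[ xs ] f ≈ ∑[ xs ] g
  ∑-cong []       f≈g = refl
  ∑-cong (x ∷ xs) f≈g = +-cong (f≈g x) (∑-cong xs f≈g)

  ∑-0 : (xs : List A) → ∑[ xs ] (λ _ → 0#) ≈ 0#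
  ∑-0 []       = refl
  ∑-0 (x ∷ xs) = trans (+-identityˡ _) (∑-0 xs)

  +-interchange : ∀ w x y z → (w + x) + (y + z) ≈ (w + y) + (x + z)
  +-interchange = CommutativeSemigroupProperties.interchange +-commutativeSemigroup

  ∑-+ : (xs : List A) (f g : A → Carrier) →
        ∑[ xs ] (λ x → f x + g x) ≈ ∑[ xs ] f + ∑[ xs ] g
  ∑-+ []       f g = sym (+-identityˡ 0#)
  ∑-+ (x ∷ xs) f g = trans (+-congˡ (∑-+ xs f g)) (+-interchange _ _ _ _)

  ∑-*ˡ : (xs : List A) (a : Carrier) (f : A → Carrier) →
         ∑[ xs ] (λ x → a * f x) ≈ a * ∑[ xs ] f
  ∑-*ˡ []       a f = sym (zeroʳ a)
  ∑-*ˡ (x ∷ xs) a f = trans (+-congˡ (∑-*ˡ xs a f)) (sym (distribˡ a _ _))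

  ∑-*ʳ : (xs : List A) (a : Carrier) (f : A → Carrier) →
         ∑[ xs ] (λ x → f x * a) ≈ ∑[ xs ] f * a
  ∑-*ʳ xs a f = trans (∑-cong xs λ _ → *-comm _ a) (trans (∑-*ˡ xs a f) (*-comm a _))

  ∑-· : (xs : List A) (n : ℕ) (f : A → Carrier) →
        ∑[ xs ] (λ x → n · f x) ≈ n · ∑[ xs ] f
  ∑-· xs zero    f = ∑-0 xs
  ∑-· xs (suc n) f = trans (∑-+ xs f _) (+-congˡ (∑-· xs n f))

  ∑-swap : (xs : List A) (ys : List B) (f : A → B → Carrier) →
           ∑[ xs ] (λ x → ∑[ ys ] (f x)) ≈ ∑[ ys ] (λ y → ∑[ xs ] (λ x → f x y))
  ∑-swap []       ys f = sym (∑-0 ys)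
  ∑-swap (x ∷ xs) ys f = trans (+-congˡ (∑-swap xs ys f)) (sym (∑-+ ys (f x) _))

  ∑-++ : (xs ys : List A) (f : A → Carrier) → ∑[ xs ++ ys ] f ≈ ∑[ xs ] f + ∑[ ys ] f
  ∑-++ []       ys f = sym (+-identityˡ _)
  ∑-++ (x ∷ xs) ys f = trans (+-congˡ (∑-++ xs ys f)) (sym (+-assoc _ _ _))

  ∑-map : (g : A → B) (xs : List A) (f : B → Carrier) → ∑[ map g xs ] f ≈ ∑[ xs ] (f ∘ g)
  ∑-map g []       f = refl
  ∑-map g (x ∷ xs) f = +-congˡ (∑-map g xs f)

  ∑-concatMap : (g : A → List B) (xs : List A) (f : B → Carrier) →
                ∑[ concatMap g xs ] f ≈ ∑[ xs ] (λ x → ∑[ g x ] f)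
  ∑-concatMap g []       f = refl
  ∑-concatMap g (x ∷ xs) f = trans (∑-++ (g x) _ f) (+-congˡ (∑-concatMap g xs f))

  ∑-cartesianProductWith : (g : A → B → C) (xs : List A) (ys : List B) (f : C → Carrier) →
    ∑[ cartesianProductWith g xs ys ] f ≈ ∑[ xs ] (λ x → ∑[ ys ] (f ∘ g x))
  ∑-cartesianProductWith g []       ys f = refl
  ∑-cartesianProductWith g (x ∷ xs) ys f =
    trans (∑-++ (map (g x) ys) _ f)
          (+-cong (∑-map (g x) ys f) (∑-cartesianProductWith g xs ys f))

  ∑-tabulate : (g : Fin n → A) (f : A → Carrier) → ∑[ tabulate g ] f ≈ sum (f ∘ g)
  ∑-tabulate {n = zero}  g f = refl
  ∑-tabulate {n = suc n} g f = +-congˡ (∑-tabulate (g ∘ suc) f)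

  ∑-applyUpTo : (g : ℕ → A) (n : ℕ) (f : A → Carrier) →
                ∑[ applyUpTo g n ] f ≈ sum {n} (f ∘ g ∘ toℕ)
  ∑-applyUpTo g zero    f = refl
  ∑-applyUpTo g (suc n) f = +-congˡ (∑-applyUpTo (g ∘ suc) n f)

  ∑-upTo-suc : (n : ℕ) (f : ℕ → Carrier) → ∑[ upTo (suc n) ] f ≈ ∑[ upTo n ] f + f n
  ∑-upTo-suc n f = begin
    ∑[ upTo (suc n) ] f          ≡⟨ ≡.cong (λ xs → ∑[ xs ] f) (upTo-∷ʳ n) ⟨
    ∑[ upTo n ++ n ∷ [] ] f      ≈⟨ ∑-++ (upTo n) (n ∷ []) f ⟩
    ∑[ upTo n ] f + (f n + 0#)   ≈⟨ +-congˡ (+-identityʳ (f n)) ⟩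
    ∑[ upTo n ] f + f n          ∎

  -- Distributivity: a term is chosen from each factor. It turns products of geometric series into
  -- sums over words, and products of determinants into sums over tuples of permutations.
  ∏-∑ : (xs : List A) (f : Fin r → A → Carrier) →
        ∏ (λ p → ∑[ xs ] (f p)) ≈ ∑[ tuples r xs ] (λ v → ∏ (λ p → f p (lookup v p)))
  ∏-∑ {r = zero}  xs f = sym (+-identityʳ 1#)
  ∏-∑ {r = suc r} xs f = begin
    ∑[ xs ] (f zero) * ∏ (λ p → ∑[ xs ] (f (suc p)))
      ≈⟨ *-congˡ (∏-∑ xs (f ∘ suc)) ⟩
    ∑[ xs ] (f zero) * ∑[ tuples r xs ] (λ v → ∏ (λ p → f (suc p) (lookup v p)))
      ≈⟨ ∑-*ʳ xs _ (f zero) ⟨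
    ∑[ xs ] (λ x → f zero x * ∑[ tuples r xs ] (λ v → ∏ (λ p → f (suc p) (lookup v p))))
      ≈⟨ ∑-cong xs (λ x → sym (∑-*ˡ (tuples r xs) (f zero x) _)) ⟩
    ∑[ xs ] (λ x → ∑[ tuples r xs ] (λ v → f zero x * ∏ (λ p → f (suc p) (lookup v p))))
      ≈⟨ ∑-cartesianProductWith Vec._∷_ xs (tuples r xs) _ ⟨
    ∑[ tuples (suc r) xs ] (λ v → ∏ (λ p → f p (lookup v p))) ∎

  ∏-^ : (f : Fin n → Carrier) (k : ℕ) → ∏ f ^ k ≈ ∏ (λ i → f i ^ k)
  ∏-^ {n = zero}  f zero    = refl
  ∏-^ {n = zero}  f (suc k) = trans (*-identityˡ _) (∏-^ f k)
  ∏-^ {n = suc n} f k       = trans (^-distrib-* _ _ k) (*-congˡ (∏-^ (f ∘ suc) k))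

  *-*-distribˡ-sum : (a b : Carrier) (f : Fin n → Carrier) →
                     a * (b * sum f) ≈ sum (λ i → a * (b * f i))
  *-*-distribˡ-sum a b f = trans (*-congˡ (*-distribˡ-sum b f)) (*-distribˡ-sum a (λ i → b * f i))

  -- Determinants

  alternatingSign : Fin n → Carrier
  alternatingSign zero    = 1#
  alternatingSign (suc j) = - 1# * alternatingSign j

  -- Position 0 is inverted with the positions whose value lies below `j`. There are `j` of these,
  -- in whatever order `π` lists the values. The inversions among the other positions are those of
  -- `π`, since `punchIn j` preserves order.
  sgn-insert : (j : Fin (suc n)) (π : Permutation′ n) →
               sgn (insert zero j π) ≈ alternatingSign j * sgn π
  sgn-insert j π =
    *-cong (trans (*-identityˡ _)
                  (trans (sym (∏-permute (λ k → if does (punchIn j k <? j) then - 1# else 1#) π))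
                         (inversions j)))
           (∏-cong λ i → trans (*-identityˡ _) (∏-cong λ k →
             reflexive (≡.cong (λ t → if does (i <? k) then (if t then - 1# else 1#) else 1#)
                               (punchIn-<? j (π ⟨$⟩ʳ k) (π ⟨$⟩ʳ i)))))
    where
    inversions : ∀ {n} (j : Fin (suc n)) →
      ∏ {n} (λ k → if does (punchIn j k <? j) then - 1# else 1#) ≈ alternatingSign j
    inversions {n}     zero    = ∏-replicate-1 n
    inversions {suc n} (suc j) = *-congˡ (inversions j)

  minor : Fin (suc n) → Fin (suc n) → (Fin (suc n) → Fin (suc n) → Carrier) →
          Fin n → Fin n → Carrier
  minor i j M k l = M (punchIn i k) (punchIn j l)

  det-cong : {M M′ : Fin n → Fin n → Carrier} → (∀ i j → M i j ≈ M′ i j) → det M ≈ det M′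
  det-cong {n} M≈M′ = ∑-cong (𝔖 n) λ σ → *-congˡ (∏-cong λ i → M≈M′ i (σ ⟨$⟩ʳ i))

  -- `𝔖 (suc n)` is enumerated by the image `j` of 0, so grouping the permutations by `j` is the
  -- Laplace expansion.
  det-expandRow : (M : Fin (suc n) → Fin (suc n) → Carrier) →
    det M ≈ sum (λ j → alternatingSign j * (M zero j * det (minor zero j M)))
  det-expandRow {n} M = begin
    det M
      ≈⟨ ∑-cartesianProductWith (insert zero) (allFin (suc n)) (𝔖 n) _ ⟩
    ∑[ allFin (suc n) ] (λ j → ∑[ 𝔖 n ] λ π →
      sgn (insert zero j π) * (M zero j * ∏ λ i → minor zero j M i (π ⟨$⟩ʳ i)))
      ≈⟨ ∑-tabulate {n = suc n} id _ ⟩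
    sum (λ j → ∑[ 𝔖 n ] λ π →
      sgn (insert zero j π) * (M zero j * ∏ λ i → minor zero j M i (π ⟨$⟩ʳ i)))
      ≈⟨ sum-cong-≋ {suc n} (λ j → trans
           (∑-cong (𝔖 n) λ π → trans (*-congʳ (sgn-insert j π))
             (regroup (alternatingSign j) (sgn π) (M zero j) _))
           (trans (∑-*ˡ (𝔖 n) (alternatingSign j) (λ π → M zero j * summand j π))
                  (*-congˡ (∑-*ˡ (𝔖 n) (M zero j) (summand j))))) ⟩
    sum (λ j → alternatingSign j * (M zero j * det (minor zero j M))) ∎
    where
    summand : Fin (suc n) → Permutation′ n → Carrier
    summand j π = sgn π * ∏ λ i → minor zero j M i (π ⟨$⟩ʳ i)

    regroup : ∀ s t m p → (s * t) * (m * p) ≈ s * (m * (t * p))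
    regroup = solve 4 (λ s t m p → (s ⊕ t) ⊕ (m ⊕ p) ⊜ s ⊕ (m ⊕ (t ⊕ p))) refl

  -- Expanding along the first row and then the first column of each minor gives
  -- the same double sum as expanding in the opposite order.
  det-expandColumn : (M : Fin (suc n) → Fin (suc n) → Carrier) →
    det M ≈ sum (λ i → alternatingSign i * (M i zero * det (minor i zero M)))
  det-expandColumn {zero}  M = det-expandRow M
  det-expandColumn {suc n} M = begin
    det M
      ≈⟨ det-expandRow M ⟩
    corner + sum (λ j → alternatingSign (suc j) * (M zero (suc j) * det (minor zero (suc j) M)))
      ≈⟨ +-congˡ (sum-cong-≋ λ j →
           trans (*-congˡ (*-congˡ (det-expandColumn (minor zero (suc j) M)))) (pull j)) ⟩
    corner + sum (λ j → sum λ i → entry i j)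
      ≈⟨ +-congˡ (∑-comm (λ j i → entry i j)) ⟩
    corner + sum (λ i → sum λ j → entry i j)
      ≈⟨ +-congˡ (sum-cong-≋ λ i →
           sym (trans (*-congˡ (*-congˡ (det-expandRow (minor (suc i) zero M)))) (pull′ i))) ⟩
    corner + sum (λ i → alternatingSign (suc i) * (M (suc i) zero * det (minor (suc i) zero M)))
      ∎
    where
    corner : Carrier
    corner = alternatingSign {suc (suc n)} zero * (M zero zero * det (minor zero zero M))

    inner : Fin (suc n) → Fin (suc n) → Carrier
    inner i j = det (λ k l → M (suc (punchIn i k)) (suc (punchIn j l)))

    entry : Fin (suc n) → Fin (suc n) → Carrier
    entry i j = alternatingSign (suc j) *
      (M zero (suc j) * (alternatingSign i * (M (suc i) zero * inner i j)))

    pull : ∀ j →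
      alternatingSign (suc j) * (M zero (suc j) *
        sum (λ i → alternatingSign i * (M (suc i) zero * inner i j)))
      ≈ sum (λ i → entry i j)
    pull j = *-*-distribˡ-sum (alternatingSign (suc j)) (M zero (suc j))
      (λ i → alternatingSign i * (M (suc i) zero * inner i j))

    -- With `u = - 1#`: the extra sign in `alternatingSign (suc i)` passes to
    -- `alternatingSign (suc j)`.
    regroup : ∀ u s p t q d →
      (u * s) * (p * (t * (q * d))) ≈ (u * t) * (q * (s * (p * d)))
    regroup = solve 6
      (λ u s p t q d → (u ⊕ s) ⊕ (p ⊕ (t ⊕ (q ⊕ d))) ⊜ (u ⊕ t) ⊕ (q ⊕ (s ⊕ (p ⊕ d)))) refl

    pull′ : ∀ i →
      alternatingSign (suc i) * (M (suc i) zero *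
        sum (λ j → alternatingSign j * (M zero (suc j) * inner i j)))
      ≈ sum (λ j → entry i j)
    pull′ i = trans
      (*-*-distribˡ-sum (alternatingSign (suc i)) (M (suc i) zero)
        (λ j → alternatingSign j * (M zero (suc j) * inner i j)))
      (sum-cong-≋ {suc n} λ j →
        regroup (- 1#) (alternatingSign i) (M (suc i) zero) (alternatingSign j) (M zero (suc j))
          (inner i j))

  -- By induction on the minors, the row expansion of `M` becomes the column expansion of its
  -- transpose.
  det-transpose : (M : Fin n → Fin n → Carrier) → det M ≈ det (λ i j → M j i)
  det-transpose {zero}  M = refl
  det-transpose {suc n} M = begin
    det M
      ≈⟨ det-expandRow M ⟩
    sum (λ j → alternatingSign j * (M zero j * det (minor zero j M)))
      ≈⟨ sum-cong-≋ {suc n} (λ j →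
           *-congˡ {alternatingSign j} (*-congˡ {M zero j} (det-transpose (minor zero j M)))) ⟩
    sum (λ j → alternatingSign j * (M zero j * det (λ k l → minor zero j M l k)))
      ≈⟨ det-expandColumn (λ i j → M j i) ⟨
    det (λ i j → M j i) ∎

  -- `T` is a function of ordered pairs of distinct indices, and each pair cancels against its
  -- exchange. The pairs containing 0, `T zero j` and `T (suc j) zero`, are cancelled first and the
  -- rest by induction, so there is no division by 2.
  sum-antisymmetric : (T : Fin (suc n) → Fin n → Carrier) →
    (∀ j k → T j k + T (punchIn j k) (pinch k j) ≈ 0#) → sum (λ j → sum (T j)) ≈ 0#
  sum-antisymmetric {zero}  T T-anti = +-identityˡ 0#
  sum-antisymmetric {suc n} T T-anti = begin
    sum (T zero) + sum (λ j → T (suc j) zero + sum (λ k → T (suc j) (suc k)))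
      ≈⟨ +-congˡ (∑-distrib-+ (λ j → T (suc j) zero) (λ j → sum (λ k → T (suc j) (suc k)))) ⟩
    sum (T zero) + (sum (λ j → T (suc j) zero) + sum (λ j → sum (λ k → T (suc j) (suc k))))
      ≈⟨ +-assoc _ _ _ ⟨
    (sum (T zero) + sum (λ j → T (suc j) zero)) + sum (λ j → sum (λ k → T (suc j) (suc k)))
      ≈⟨ +-cong (trans (sym (∑-distrib-+ (T zero) (λ j → T (suc j) zero)))
                       (trans (sum-cong-≋ {suc n} (T-anti zero)) (sum-replicate-zero (suc n))))
                (sum-antisymmetric (λ j k → T (suc j) (suc k)) λ j k → T-anti (suc j) (suc k)) ⟩
    0# + 0#
      ≈⟨ +-identityˡ 0# ⟩
    0# ∎

  x+-1*x≈0 : ∀ x → x + - 1# * x ≈ 0#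
  x+-1*x≈0 x = trans (+-congˡ (-1*x≈-x x)) (-‿inverseʳ x)

  -1*-1*x≈x : ∀ x → - 1# * (- 1# * x) ≈ x
  -1*-1*x≈x x = trans (-1*x≈-x _) (trans (-‿cong (-1*x≈-x x)) (-‿involutive x))

  -- The pair `punchIn j k`, `pinch k j` is `k + 1`, `j` if `j ≤ k`, and `k`, `j - 1` otherwise;
  -- either way the parity of the sum of the indices changes.
  alternatingSign-pinch : (j : Fin (suc n)) (k : Fin n) →
    alternatingSign (punchIn j k) * alternatingSign (pinch k j)
      ≈ - 1# * (alternatingSign j * alternatingSign k)
  alternatingSign-pinch {suc _} zero k =
    trans (*-identityʳ _) (*-congˡ (sym (*-identityˡ _)))
  alternatingSign-pinch (suc j) zero = begin
    1# * alternatingSign j                      ≈⟨ *-identityˡ _ ⟩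
    alternatingSign j                           ≈⟨ -1*-1*x≈x _ ⟨
    - 1# * (- 1# * alternatingSign j)           ≈⟨ *-congˡ (*-identityʳ _) ⟨
    - 1# * ((- 1# * alternatingSign j) * 1#)    ∎
  alternatingSign-pinch (suc j) (suc k) = begin
    (- 1# * s′) * (- 1# * t′)          ≈⟨ shuffle (- 1#) s′ t′ ⟩
    - 1# * (- 1# * (s′ * t′))          ≈⟨ *-congˡ (*-congˡ (alternatingSign-pinch j k)) ⟩
    - 1# * (- 1# * (- 1# * (s * t)))   ≈⟨ *-congˡ (shuffle (- 1#) s t) ⟨
    - 1# * ((- 1# * s) * (- 1# * t))   ∎
    where
    s = alternatingSign j
    t = alternatingSign k
    s′ = alternatingSign (punchIn j k)
    t′ = alternatingSign (pinch k j)
    shuffle : ∀ u s t → (u * s) * (u * t) ≈ u * (u * (s * t))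
    shuffle = solve 3 (λ u s t → (u ⊕ s) ⊕ (u ⊕ t) ⊜ u ⊕ (u ⊕ (s ⊕ t))) refl

  -- Alternating and symmetric functions of words

  -- Exchanging adjacent letters multiplies `F` by `s`, and `F` vanishes when adjacent letters
  -- agree: alternating for `s = - 1#`, symmetric for `s = 1#`. Vanishing is a separate clause
  -- because the swap rule does not imply it for `s = 1#`, nor for `s = - 1#` where 2 is a zero
  -- divisor.
  Swap : {A : Set a} → Carrier → (Vec A n → Carrier) → Set (a ⊔ ℓ)
  Swap {n = zero}        s F = ⊤
  Swap {n = suc zero}    s F = ⊤
  Swap {n = suc (suc n)} s F =
    (∀ a b v → F (a Vec.∷ b Vec.∷ v) ≈ s * F (b Vec.∷ a Vec.∷ v)) ×
    (∀ a v → F (a Vec.∷ a Vec.∷ v) ≈ 0#) ×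
    (∀ a → Swap s (F ∘ (a Vec.∷_)))

  Swap-tail : {A : Set a} {s : Carrier} (F : Vec A (suc n) → Carrier) →
              Swap s F → ∀ a → Swap s (F ∘ (a Vec.∷_))
  Swap-tail {n = zero}  F _           = λ _ → tt
  Swap-tail {n = suc n} F (_ , _ , h) = h

  Swap-cong : {A : Set a} {s t : Carrier} {F G : Vec A n → Carrier} →
              s ≈ t → (∀ v → F v ≈ G v) → Swap s F → Swap t G
  Swap-cong {n = zero}        s≈t F≈G _ = tt
  Swap-cong {n = suc zero}    s≈t F≈G _ = tt
  Swap-cong {n = suc (suc n)} s≈t F≈G (swap , vanish , h) =
    (λ a b v → trans (sym (F≈G _)) (trans (swap a b v) (*-cong s≈t (F≈G _)))) ,
    (λ a v → trans (sym (F≈G _)) (vanish a v)) ,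
    (λ a → Swap-cong s≈t (λ v → F≈G (a Vec.∷ v)) (h a))

  Swap-sum : {A : Set a} {s : Carrier} (c : Fin k → Carrier) {F : Fin k → Vec A n → Carrier} →
             (∀ j → Swap s (F j)) → Swap s (λ v → sum (λ j → c j * F j v))
  Swap-sum {n = zero}        c h = tt
  Swap-sum {n = suc zero}    c h = tt
  Swap-sum {k = k} {n = suc (suc n)} {s = s} c {F} h =
    (λ a b v → trans
      (sum-cong-≋ {k} λ j →
        let (swap , _ , _) = h j in trans (*-congˡ (swap a b v)) (x∙yz≈y∙xz (c j) s _))
      (sym (*-distribˡ-sum s (λ j → c j * F j (b Vec.∷ a Vec.∷ v))))) ,
    (λ a v → trans
      (sum-cong-≋ {k} λ j →
        let (_ , vanish , _) = h j in trans (*-congˡ (vanish a v)) (zeroʳ (c j)))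
      (sum-replicate-zero k)) ,
    (λ a → Swap-sum c λ j → Swap-tail (F j) (h j) a)

  -- Each factor contributes one `s`. A single vanishing factor kills the product, so there must be
  -- at least one factor.
  Swap-∏ : {A : Set a} .{{_ : NonZero k}} {s : Carrier} {F : Fin k → Vec A n → Carrier} →
           (∀ p → Swap s (F p)) → Swap (s ^ k) (λ v → ∏ (λ p → F p v))
  Swap-∏ {n = zero}        h = tt
  Swap-∏ {n = suc zero}    h = tt
  Swap-∏ {k = k@(suc _)} {n = suc (suc n)} {s = s} {F} h =
    (λ a b v → trans
      (∏-cong {k} λ p → let (swap , _ , _) = h p in swap a b v)
      (trans (∏-distrib-* {k} (λ _ → s) (λ p → F p (b Vec.∷ a Vec.∷ v))) (*-congʳ (∏-replicate k)))) ,
    (λ a v → let (_ , vanish , _) = h zero in trans (*-congʳ (vanish a v)) (zeroˡ _)) ,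
    (λ a → Swap-∏ λ p → Swap-tail (F p) (h p) a)

  rowDet : {A : Set a} → (A → Fin n → Carrier) → Vec A n → Carrier
  rowDet row v = det (λ i → row (lookup v i))

  -- The coefficients do not depend on `v`: as a function of the tail, the determinant is a linear
  -- combination of smaller ones, the form that `Swap-sum` treats.
  rowDet-∷ : {A : Set a} (row : A → Fin (suc n) → Carrier) (a : A) (v : Vec A n) →
    rowDet row (a Vec.∷ v) ≈
      sum (λ j → (alternatingSign j * row a j) * rowDet (λ b c → row b (punchIn j c)) v)
  rowDet-∷ {n = n} row a v = trans
    (det-expandRow (λ i → row (lookup (a Vec.∷ v) i)))
    (sum-cong-≋ {suc n} λ j → sym (*-assoc (alternatingSign j) (row a j)
      (rowDet (λ b c → row b (punchIn j c)) v)))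

  module _ {A : Set a} (row : A → Fin (suc (suc n)) → Carrier) (v : Vec A n) where

    private
      cofactor : Fin (suc (suc n)) → Fin (suc n) → Carrier
      cofactor j k = rowDet (λ b c → row b (punchIn j (punchIn k c))) v

      -- The contribution to the expansion along the first two rows in which `a` uses column `j` and
      -- `b` uses column `punchIn j k`.
      term : A → A → Fin (suc (suc n)) → Fin (suc n) → Carrier
      term a b j k =
        (alternatingSign j * alternatingSign k) * (row a j * (row b (punchIn j k) * cofactor j k))

      expand : ∀ a b → rowDet row (a Vec.∷ b Vec.∷ v) ≈ sum (λ j → sum (term a b j))
      expand a b = trans (rowDet-∷ row a (b Vec.∷ v)) (sum-cong-≋ {suc (suc n)} λ j → trans
        (*-congˡ (rowDet-∷ (λ b c → row b (punchIn j c)) b v))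
        (trans
          (*-distribˡ-sum (alternatingSign j * row a j)
            (λ k → (alternatingSign k * row b (punchIn j k)) * cofactor j k))
          (sum-cong-≋ {suc n} λ k →
            regroup (alternatingSign j) (row a j) (alternatingSign k) (row b (punchIn j k)) (cofactor j k))))
        where
        regroup : ∀ s p t q d → (s * p) * ((t * q) * d) ≈ (s * t) * (p * (q * d))
        regroup = solve 5 (λ s p t q d → (s ⊕ p) ⊕ ((t ⊕ q) ⊕ d) ⊜ (s ⊕ t) ⊕ (p ⊕ (q ⊕ d))) refl

      -- Exchanging the rows together with their columns keeps both entries and deletes the same two
      -- columns, so only the sign changes.
      term-flip : ∀ a b j k → term b a (punchIn j k) (pinch k j) ≈ - 1# * term a b j k
      term-flip a b j k = trans
        (*-cong (alternatingSign-pinch j k)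
          (trans (*-congˡ (*-cong (reflexive (≡.cong (row a) (punchIn-pinch j k)))
                                  (det-cong λ i c → reflexive (≡.cong (row (lookup v i))
                                    (≡.sym (punchIn-punchIn j k c))))))
                 (x∙yz≈y∙xz _ _ _)))
        (*-assoc _ _ _)

    rowDet-vanish : ∀ a → rowDet row (a Vec.∷ a Vec.∷ v) ≈ 0#
    rowDet-vanish a = trans (expand a a) (sum-antisymmetric (term a a) λ j k →
      trans (+-congˡ (term-flip a a j k)) (x+-1*x≈0 _))

    rowDet-swap : ∀ a b → rowDet row (a Vec.∷ b Vec.∷ v) ≈ - 1# * rowDet row (b Vec.∷ a Vec.∷ v)
    rowDet-swap a b = trans (+-inverseˡ-unique _ _ sum≈0) (sym (-1*x≈-x _))
      where
      -- For distinct rows `term a b` alone need not be antisymmetric; adding the term with the rows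
      -- exchanged makes it so.
      both : Fin (suc (suc n)) → Fin (suc n) → Carrier
      both j k = term a b j k + term b a j k

      both-anti : ∀ j k → both j k + both (punchIn j k) (pinch k j) ≈ 0#
      both-anti j k = begin
        both j k + both (punchIn j k) (pinch k j)
          ≈⟨ +-congˡ (trans (+-comm _ _) (+-cong (term-flip a b j k) (term-flip b a j k))) ⟩
        both j k + (- 1# * term a b j k + - 1# * term b a j k)
          ≈⟨ +-congˡ (distribˡ (- 1#) _ _) ⟨
        both j k + - 1# * both j k
          ≈⟨ x+-1*x≈0 _ ⟩
        0# ∎

      sum≈0 : rowDet row (a Vec.∷ b Vec.∷ v) + rowDet row (b Vec.∷ a Vec.∷ v) ≈ 0#
      sum≈0 = begin
        rowDet row (a Vec.∷ b Vec.∷ v) + rowDet row (b Vec.∷ a Vec.∷ v)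
          ≈⟨ +-cong (expand a b) (expand b a) ⟩
        sum (λ j → sum (term a b j)) + sum (λ j → sum (term b a j))
          ≈⟨ ∑-distrib-+ (λ j → sum (term a b j)) (λ j → sum (term b a j)) ⟨
        sum (λ j → sum (term a b j) + sum (term b a j))
          ≈⟨ sum-cong-≋ {suc (suc n)} (λ j → sym (∑-distrib-+ (term a b j) (term b a j))) ⟩
        sum (λ j → sum (both j))
          ≈⟨ sum-antisymmetric both both-anti ⟩
        0# ∎

  -- Swaps of the first two rows are treated directly; those further down follow by expanding along
  -- the first row and induction on the minors.
  Swap-rowDet : {A : Set a} (row : A → Fin n → Carrier) → Swap (- 1#) (rowDet row)
  Swap-rowDet {n = zero}        row = tt
  Swap-rowDet {n = suc zero}    row = tt
  Swap-rowDet {n = suc (suc n)} row =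
    (λ a b v → rowDet-swap row v a b) ,
    (λ a v → rowDet-vanish row v a) ,
    (λ a → Swap-cong refl (λ v → sym (rowDet-∷ row a v))
      (Swap-sum (λ j → alternatingSign j * row a j)
        λ j → Swap-rowDet (λ b c → row b (punchIn j c))))

  -- Sums of symmetric functions

  wordSum : ℕ → (Vec ℕ n → Carrier) → Carrier
  wordSum {n} M G = ∑[ tuples n (upTo M) ] G

  wordSum-suc : (M : ℕ) (G : Vec ℕ (suc n) → Carrier) →
    wordSum M G ≈ ∑[ upTo M ] (λ k → wordSum M (G ∘ (k Vec.∷_)))
  wordSum-suc {n} M G = ∑-cartesianProductWith Vec._∷_ (upTo M) (tuples n (upTo M)) G

  -- The words over {0, …, M} that contain M exactly once, M being moved to the front.
  maxOnceSum : ℕ → (Vec ℕ n → Carrier) → Carrier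
  maxOnceSum {zero}  M G = 0#
  maxOnceSum {suc n} M G = suc n · wordSum M (G ∘ (M Vec.∷_))

  -- Words using `M` more than once contribute 0, and by symmetry a single `M` may be moved to the
  -- front. The proof is by induction on the length, separating the first letter.
  wordSum-peel : (M : ℕ) (G : Vec ℕ n → Carrier) → Swap 1# G →
    wordSum (suc M) G ≈ wordSum M G + maxOnceSum M G
  wordSum-peel {zero}  M G h = sym (+-identityʳ _)
  wordSum-peel {suc n} M G h = begin
    wordSum (suc M) G
      ≈⟨ wordSum-suc (suc M) G ⟩
    ∑[ upTo (suc M) ] (λ k → wordSum (suc M) (G ∘ (k Vec.∷_)))
      ≈⟨ ∑-cong (upTo (suc M)) (λ k → wordSum-peel M (G ∘ (k Vec.∷_)) (Swap-tail G h k)) ⟩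
    ∑[ upTo (suc M) ] (λ k → wordSum M (G ∘ (k Vec.∷_)) + maxOnceSum M (G ∘ (k Vec.∷_)))
      ≈⟨ ∑-upTo-suc M _ ⟩
    ∑[ upTo M ] (λ k → wordSum M (G ∘ (k Vec.∷_)) + maxOnceSum M (G ∘ (k Vec.∷_)))
      + (wordSum M (G ∘ (M Vec.∷_)) + maxOnceSum M (G ∘ (M Vec.∷_)))
      ≈⟨ +-cong (trans (∑-+ (upTo M) _ _) (+-cong (sym (wordSum-suc M G)) (once h)))
                (trans (+-congˡ (twice h)) (+-identityʳ _)) ⟩
    -- The letter `M` stands in one of the `n` later positions or in the first, which together gives
    -- `suc n`.
    (wordSum M G + n · wordSum M (G ∘ (M Vec.∷_))) + wordSum M (G ∘ (M Vec.∷_))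
      ≈⟨ trans (+-assoc _ _ _) (+-congˡ (+-comm _ _)) ⟩
    wordSum M G + suc n · wordSum M (G ∘ (M Vec.∷_)) ∎
    where
    -- First letter below `M`: `maxOnceSum` has already moved `M` to the second place, and one swap
    -- brings it to the front.
    once : ∀ {n} {G : Vec ℕ (suc n) → Carrier} → Swap 1# G →
      ∑[ upTo M ] (λ k → maxOnceSum M (G ∘ (k Vec.∷_))) ≈ n · wordSum M (G ∘ (M Vec.∷_))
    once {zero}          h = ∑-0 (upTo M)
    once {suc n} {G = G} (swap , _) = begin
      ∑[ upTo M ] (λ k → suc n · wordSum M (λ v → G (k Vec.∷ M Vec.∷ v)))
        ≈⟨ ∑-· (upTo M) (suc n) _ ⟩
      suc n · ∑[ upTo M ] (λ k → wordSum M (λ v → G (k Vec.∷ M Vec.∷ v)))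
        ≈⟨ ×-congʳ (suc n) (∑-cong (upTo M) λ k → ∑-cong (tuples n (upTo M)) λ v →
             trans (swap k M v) (*-identityˡ _)) ⟩
      suc n · ∑[ upTo M ] (λ k → wordSum M (λ v → G (M Vec.∷ k Vec.∷ v)))
        ≈⟨ ×-congʳ (suc n) (wordSum-suc M (G ∘ (M Vec.∷_))) ⟨
      suc n · wordSum M (G ∘ (M Vec.∷_)) ∎

    -- First letter `M`: another `M`, moved to the second place, makes the first two letters equal.
    twice : ∀ {n} {G : Vec ℕ (suc n) → Carrier} → Swap 1# G → maxOnceSum M (G ∘ (M Vec.∷_)) ≈ 0#
    twice {zero}  h = refl
    twice {suc n} (_ , vanish , _) = trans
      (×-congʳ (suc n) (trans (∑-cong (tuples n (upTo M)) (vanish M)) (∑-0 (tuples n (upTo M)))))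
      (×-idem (+-identityˡ 0#) (suc n))

  -- Fewer letters than positions force a repetition. Peeling off the largest letter leaves sums
  -- that again have fewer letters than positions, down to the empty alphabet, over which there are
  -- no words of positive length.
  wordSum-pigeonhole : {M : ℕ} → M < n → (G : Vec ℕ n → Carrier) → Swap 1# G → wordSum M G ≈ 0#
  wordSum-pigeonhole {M = zero}  (s≤s z≤n) G h = refl
  wordSum-pigeonhole {n = suc n} {M = suc M} (s≤s M<n) G h = begin
    wordSum (suc M) G
      ≈⟨ wordSum-peel M G h ⟩
    wordSum M G + suc n · wordSum M (G ∘ (M Vec.∷_))
      ≈⟨ +-cong (wordSum-pigeonhole (ℕ.m<n⇒m<1+n M<n) G h)
                (×-congʳ (suc n) (wordSum-pigeonhole M<n (G ∘ (M Vec.∷_)) (Swap-tail G h M))) ⟩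
    0# + suc n · 0#
      ≈⟨ trans (+-identityˡ _) (×-idem (+-identityˡ 0#) (suc n)) ⟩
    0# ∎

  -- Through `shift` the sum runs over the strictly decreasing words with letters below `N + n`.
  partitionSum : ℕ → (Vec ℕ n → Carrier) → Carrier
  partitionSum {n} N G = ∑[ partitions n N ] (G ∘ shift)

  -- The first entry of `δ` is `n` and its tail is the `δ` of length `n`, so `shift` acts on the
  -- remaining parts as before.
  partitionSum-∷ : (N : ℕ) (G : Vec ℕ (suc n) → Carrier) →
    partitionSum N G ≈ ∑[ upTo (suc N) ] (λ k → partitionSum k (G ∘ ((k ℕ.+ n) Vec.∷_)))
  partitionSum-∷ {n} N G = trans
    (∑-concatMap (λ k → map (k Vec.∷_) (partitions n k)) (upTo (suc N)) (G ∘ shift))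
    (∑-cong (upTo (suc N)) λ k → ∑-map (k Vec.∷_) (partitions n k) (G ∘ shift))

  -- Either the first part is at most `N`, or it equals `suc N`; this is the counterpart of
  -- `wordSum-peel` for decreasing words.
  partitionSum-suc : (N : ℕ) (G : Vec ℕ (suc n) → Carrier) →
    partitionSum (suc N) G ≈
      partitionSum N G + partitionSum (suc N) (G ∘ ((suc N ℕ.+ n) Vec.∷_))
  partitionSum-suc N G = trans (partitionSum-∷ (suc N) G)
    (trans (∑-upTo-suc (suc N) _) (+-congʳ (sym (partitionSum-∷ N G))))

  -- Induction on `n` and, for fixed `n`, on `N`. Peeling off the letter `N + n` leaves words one
  -- letter shorter, counted `suc n` times, and words that avoid it, which `maxUnused` treats.
  wordSum≈n!·partitionSum : (N : ℕ) (G : Vec ℕ n → Carrier) → Swap 1# G →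
    wordSum (N ℕ.+ n) G ≈ (n !) · partitionSum N G
  wordSum≈n!·partitionSum {zero}  N G h = sym (×-homo-1 _)
  wordSum≈n!·partitionSum {suc n} N G h = begin
    wordSum (N ℕ.+ suc n) G
      ≡⟨ ≡.cong (λ M → wordSum M G) (ℕ.+-suc N n) ⟩
    wordSum (suc (N ℕ.+ n)) G
      ≈⟨ wordSum-peel (N ℕ.+ n) G h ⟩
    wordSum (N ℕ.+ n) G + suc n · wordSum (N ℕ.+ n) G′
      ≈⟨ +-congˡ (trans (×-congʳ (suc n) (wordSum≈n!·partitionSum N G′ (Swap-tail G h _)))
                        (×-assocˡ _ (suc n) (n !))) ⟩
    wordSum (N ℕ.+ n) G + (suc n !) · partitionSum N G′
      ≈⟨ maxUnused N ⟩
    (suc n !) · partitionSum N G ∎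
    where
    G′ : Vec ℕ n → Carrier
    G′ = G ∘ ((N ℕ.+ n) Vec.∷_)

    maxUnused : ∀ N → wordSum (N ℕ.+ n) G + (suc n !) · partitionSum N (G ∘ ((N ℕ.+ n) Vec.∷_))
                      ≈ (suc n !) · partitionSum N G
    maxUnused zero = begin
      wordSum n G + (suc n !) · partitionSum 0 (G ∘ (n Vec.∷_))
        -- Only `n` letters remain for `suc n` positions.
        ≈⟨ +-congʳ (wordSum-pigeonhole ℕ.≤-refl G h) ⟩
      0# + (suc n !) · partitionSum 0 (G ∘ (n Vec.∷_))
        ≈⟨ +-identityˡ _ ⟩
      (suc n !) · partitionSum 0 (G ∘ (n Vec.∷_))
        ≈⟨ ×-congʳ (suc n !) (trans (partitionSum-∷ 0 G) (+-identityʳ _)) ⟨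
      (suc n !) · partitionSum 0 G ∎
    maxUnused (suc N) = begin
      wordSum (suc N ℕ.+ n) G + (suc n !) · P
        -- The alphabet size `suc N + n` is rewritten as `N + suc n`, to which the induction
        -- hypothesis for the smaller `N` applies.
        ≡⟨ ≡.cong (λ M → wordSum M G + (suc n !) · P) (ℕ.+-suc N n) ⟨
      wordSum (N ℕ.+ suc n) G + (suc n !) · P
        ≈⟨ +-congʳ (wordSum≈n!·partitionSum N G h) ⟩
      (suc n !) · partitionSum N G + (suc n !) · P
        ≈⟨ ×-distrib-+ _ _ (suc n !) ⟨
      (suc n !) · (partitionSum N G + P)
        ≈⟨ ×-congʳ (suc n !) (partitionSum-suc N G) ⟨
      (suc n !) · partitionSum (suc N) G ∎
      where
      P = partitionSum (suc N) (G ∘ ((suc N ℕ.+ n) Vec.∷_))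

  -- The hyperdeterminant

  -- The exponents label the rows, so that exchanging letters of the word exchanges rows.
  alternant : (Fin n → Carrier) → Vec ℕ n → Carrier
  alternant x = rowDet (λ e i → x i ^ e)

  schur-alternant : (x : Fin n → Carrier) (V-unit : IsUnit (V x)) (lam : Vec ℕ n) →
    schur x V-unit lam ≈ alternant x (shift lam) / V-unit
  schur-alternant x V-unit lam = *-congʳ (trans
    -- In `schur` the exponents label columns, in `alternant` rows.
    (det-transpose (λ i j → x i ^ (lookup lam j ℕ.+ _)))
    (det-cong λ i j → reflexive (≡.cong (x j ^_) (≡.sym (lookup∘tabulate _ i)))))

  ∏-geometric : (M : ℕ) (y : Fin n → Carrier) →
    ∏ (λ i → geometric M (y i)) ≈ ∑[ tuples n (upTo M) ] (λ v → ∏ (λ i → y i ^ lookup v i))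
  ∏-geometric {n} M y = trans
    (∏-cong {n} λ i → sym (∑-applyUpTo id M (y i ^_)))
    (∏-∑ (upTo M) (λ i e → y i ^ e))

  hyperdeterminant-expand : (M : ℕ) (x : Fin r → Fin n → Carrier) →
    ∑[ tuples r (𝔖 n) ] (λ σ → ∏ (λ p → sgn (lookup σ p)) *
      ∏ (λ i → geometric M (∏ (λ p → x p (lookup σ p ⟨$⟩ʳ i)))))
    ≈ wordSum M (λ v → ∏ (λ p → alternant (x p) v))
  hyperdeterminant-expand {r} {n} M x = begin
    ∑[ tuples r (𝔖 n) ] (λ σ → ∏ (λ p → sgn (lookup σ p)) *
      ∏ (λ i → geometric M (∏ (λ p → x p (lookup σ p ⟨$⟩ʳ i)))))
      ≈⟨ ∑-cong (tuples r (𝔖 n)) (λ σ → trans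
           (*-congˡ (∏-geometric M (λ i → ∏ (λ p → x p (lookup σ p ⟨$⟩ʳ i)))))
           (trans (sym (∑-*ˡ words _ _)) (∑-cong words (factor σ)))) ⟩
    ∑[ tuples r (𝔖 n) ] (λ σ → ∑[ words ] λ v → ∏ (λ p → term v p (lookup σ p)))
      ≈⟨ ∑-swap (tuples r (𝔖 n)) words _ ⟩
    ∑[ words ] (λ v → ∑[ tuples r (𝔖 n) ] λ σ → ∏ (λ p → term v p (lookup σ p)))
      -- For a fixed word each factor depends on only one of the permutations, so the sum over
      -- tuples is a product of determinants.
      ≈⟨ ∑-cong words (λ v → ∏-∑ (𝔖 n) (term v)) ⟨
    wordSum M (λ v → ∏ (λ p → alternant (x p) v)) ∎
    where
    words : List (Vec ℕ n)
    words = tuples n (upTo M)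

    term : Vec ℕ n → Fin r → Permutation′ n → Carrier
    term v p π = sgn π * ∏ (λ i → x p (π ⟨$⟩ʳ i) ^ lookup v i)

    factor : (σ : Vec (Permutation′ n) r) (v : Vec ℕ n) →
      ∏ (λ p → sgn (lookup σ p)) * ∏ (λ i → ∏ (λ p → x p (lookup σ p ⟨$⟩ʳ i)) ^ lookup v i)
      ≈ ∏ (λ p → term v p (lookup σ p))
    factor σ v = trans
      (*-congˡ (trans
        (∏-cong {n} λ i → ∏-^ (λ p → x p (lookup σ p ⟨$⟩ʳ i)) (lookup v i))
        (∏-comm (λ i p → x p (lookup σ p ⟨$⟩ʳ i) ^ lookup v i))))
      (sym (∏-distrib-* (λ p → sgn (lookup σ p)) _))

  -1^2m≈1 : ∀ m → (- 1#) ^ (2 ℕ.* m) ≈ 1#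
  -1^2m≈1 m = begin
    (- 1#) ^ (2 ℕ.* m)   ≈⟨ ^-assocʳ (- 1#) 2 m ⟨
    ((- 1#) ^ 2) ^ m     ≈⟨ ^-congˡ m (-1*-1*x≈x 1#) ⟩
    1# ^ m               ≈⟨ ∏-replicate m ⟨
    ∏ {m} (λ _ → 1#)     ≈⟨ ∏-replicate-1 m ⟩
    1#                   ∎

theorem3p1 : ∀ {c ℓ} (R : CommutativeRing c ℓ) →
    let open CommutativeRing R
        open OverRing R in
    (m n N : ℕ) .{{_ : NonZero m}} .{{_ : NonZero n}} .{{_ : NonZero N}} →
    (n!-unit : IsUnit (fromℕ (n !))) →
    (x : Fin (2 ℕ.* m) → Fin n → Carrier) →
    (V-unit : ∀ i → IsUnit (V (x i))) →
    ∑[ partitions n N ] (λ lam → ∏ (λ i → schur (x i) (V-unit i) lam))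
      ≈ ∏ (λ i → 1# / V-unit i)
          * Det n!-unit (λ k → geometric (n ℕ.+ N) (∏ (λ i → x i (k i))))
theorem3p1 R m n N n!-unit@(n!⁻¹ , n!⁻¹*n!≈1 , _) x V-unit = begin
  ∑[ partitions n N ] (λ lam → ∏ (λ i → schur (x i) (V-unit i) lam))
    ≈⟨ ∑-cong R (partitions n N) (λ lam → trans
         (∏-cong λ i → trans (schur-alternant R (x i) (V-unit i) lam)
                             (trans (*-comm _ _) (*-congʳ (sym (*-identityˡ _)))))
         (∏-distrib-* (λ i → 1# / V-unit i) (λ i → alternant R (x i) (shift lam)))) ⟩
  ∑[ partitions n N ] (λ lam → W * G (shift lam))
    ≈⟨ ∑-*ˡ R (partitions n N) W (G ∘ shift) ⟩
  W * partitionSum R N G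
    ≈⟨ *-congˡ (begin
         partitionSum R N G
           ≈⟨ *-identityˡ _ ⟨
         1# * partitionSum R N G
           ≈⟨ *-congʳ n!⁻¹*n!≈1 ⟨
         (n!⁻¹ * fromℕ (n !)) * partitionSum R N G
           ≈⟨ *-assoc _ _ _ ⟩
         n!⁻¹ * (fromℕ (n !) * partitionSum R N G)
           ≈⟨ *-cong (sym (*-identityˡ n!⁻¹))
                     -- Multiplying by the ring element `fromℕ (n !)` is the same as adding `n !`
                     -- copies.
                     (trans (×-assoc-* (n !) 1# _) (×-congʳ (n !) (*-identityˡ _))) ⟩
         (1# / n!-unit) * ((n !) · partitionSum R N G)
           ≈⟨ *-congˡ (wordSum≈n!·partitionSum R N G G-symmetric) ⟨
         (1# / n!-unit) * wordSum R (N ℕ.+ n) G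
           ≡⟨ ≡.cong (λ M → (1# / n!-unit) * wordSum R M G) (ℕ.+-comm N n) ⟩
         (1# / n!-unit) * wordSum R (n ℕ.+ N) G
           ≈⟨ *-congˡ (hyperdeterminant-expand R (n ℕ.+ N) x) ⟨
         Det n!-unit (λ k → geometric (n ℕ.+ N) (∏ (λ i → x i (k i)))) ∎) ⟩
  W * Det n!-unit (λ k → geometric (n ℕ.+ N) (∏ (λ i → x i (k i)))) ∎
  where
  open CommutativeRing R
  open OverRing R
  open MonoidSum *-commutativeMonoid using ()
    renaming (sum-cong-≋ to ∏-cong; ∑-distrib-+ to ∏-distrib-*)
  open SemiringMult semiring using (×-assoc-*; ×-congʳ) renaming (_×_ to _·_)
  open SetoidReasoning setoid

  W : Carrier
  W = ∏ (λ i → 1# / V-unit i)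

  G : Vec ℕ n → Carrier
  G v = ∏ (λ i → alternant R (x i) v)

  G-symmetric : Swap R 1# G
  -- Evenness enters here: `2 * m` alternating factors give the swap factor `(- 1#) ^ (2 * m) ≈ 1#`.
  G-symmetric = Swap-cong R (-1^2m≈1 R m) (λ _ → refl)
    (Swap-∏ R {{ℕ.m*n≢0 2 m}} λ i → Swap-rowDet R (λ e j → x i j ^ e))
    where open Exp commutativeSemiring using (_^_)
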